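{- Let $\mathbb D=(D,\varepsilon,\nu)$ be a comonad on the category of sets, let $(Y,k)$ be any $D$-algebra, and let $k^\ddagger : DX\to Y$ be a co-Kleisli-inductive solution of $k$. Then for every $\mathbb D$-coalgebra $(X,f)$ with carrier $X$, the map $k^\ddagger\circ f : X\to Y$ is a $D$-ca-homomorphism from $(X,f)$ to $(Y,k)$.
   Context: For an endofunctor $D$ on sets, a $D$-coalgebra is a pair $(X,f)$ with $f:X\to DX$, and a $D$-algebra is a pair $(Y,k)$ with $k:DY\to Y$. A $D$-ca-homomorphism (coalgebra--algebra homomorphism) from a $D$-coalgebra $(X,f)$ to a $D$-algebra $(Y,k)$ is a map $h:X\to Y$ with $h=k\circ Dh\circ f$. For a comonad $\mathbb D=(D,\varepsilon,\nu)$ (counit $\varepsilon:D\Rightarrow 1$, comultiplication $\nu:D\Rightarrow DD$), a $\mathbb D$-coalgebra is a $D$-coalgebra $(X,f)$ with $\varepsilon_X\circ f=\mathrm{id}_X$ and $\nu_X\circ f=Df\circ f$. For $g:DX\to Y$ the co-Kleisli extension is $g^\circ=Dg\circ\nu_X:DX\to DY$. A co-Kleisli-inductive solution of a $D$-algebra $(Y,k)$ is a map $k^\ddagger:DX\to Y$ (for some set $X$) with $k^\ddagger=k\circ(k^\ddagger)^\circ$, i.e. $k^\ddagger$ equals the co-Kleisli composite of $k^\ddagger$ followed by $k$. -}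

module Defs where

open import Level using (Level; suc)
open import Function.Base using (id; _∘_)
open import Relation.Binary.PropositionalEquality using (_≗_)

-- The category of sets is rendered as the types of Set ℓ with functions as
-- morphisms, two functions being equal when they agree pointwise (_≗_).
-- Functors on it must therefore respect _≗_, whence map-cong (which is
-- automatic in the presence of function extensionality).

record Endofunctor (ℓ : Level) : Set (suc ℓ) where
  field
    F₀       : Set ℓ → Set ℓ
    map      : ∀ {A B} → (A → B) → F₀ A → F₀ B
    map-cong : ∀ {A B} {g h : A → B} → g ≗ h → map g ≗ map h
    map-id   : ∀ {A} → map (id {A = A}) ≗ id
    map-∘    : ∀ {A B C} (h : B → C) (g : A → B) → map (h ∘ g) ≗ map h ∘ map g

module _ {ℓ} (D : Endofunctor ℓ) where
  open Endofunctor D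

  Coalgebra : Set ℓ → Set ℓ
  Coalgebra X = X → F₀ X

  Algebra : Set ℓ → Set ℓ
  Algebra Y = F₀ Y → Y

  IsCAHomomorphism : ∀ {X Y} → Coalgebra X → Algebra Y → (X → Y) → Set ℓ
  IsCAHomomorphism f k h = h ≗ k ∘ map h ∘ f

record Comonad (ℓ : Level) : Set (suc ℓ) where
  field
    functor : Endofunctor ℓ
  open Endofunctor functor public
  field
    ε         : ∀ {A} → F₀ A → A
    ν         : ∀ {A} → F₀ A → F₀ (F₀ A)
    ε-natural : ∀ {A B} (g : A → B) → ε ∘ map g ≗ g ∘ ε
    ν-natural : ∀ {A B} (g : A → B) → ν ∘ map g ≗ map (map g) ∘ ν
    identityˡ : ∀ {A} → ε ∘ ν ≗ id {A = F₀ A}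
    identityʳ : ∀ {A} → map ε ∘ ν ≗ id {A = F₀ A}
    assoc     : ∀ {A} → ν ∘ ν {A} ≗ map ν ∘ ν

module _ {ℓ} (𝔻 : Comonad ℓ) where
  open Comonad 𝔻

  record IsComonadCoalgebra {X : Set ℓ} (f : Coalgebra functor X) : Set ℓ where
    field
      counit : ε ∘ f ≗ id
      comult : ν ∘ f ≗ map f ∘ f

  coKleisliExtension : ∀ {X Y} → (F₀ X → Y) → F₀ X → F₀ Y
  coKleisliExtension g = map g ∘ ν

  IsCoKleisliInductiveSolution : ∀ {X Y} → Algebra functor Y → (F₀ X → Y) → Set ℓ
  IsCoKleisliInductiveSolution k k‡ = k‡ ≗ k ∘ coKleisliExtension k‡

{-# OPTIONS --safe #-}
module Submission where

open import Defs
open import Function.Base using (_∘_)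
open import Relation.Binary.PropositionalEquality using (cong; module ≡-Reasoning)

-- At `f x`, the equation for `k‡` has `ν (f x)` where the homomorphism equation calls for
-- `map f (f x)`. Compatibility of `f` with `ν` identifies the two, and functoriality merges
-- `map k‡` with `map f`.

theorem2p13 : ∀ {ℓ} (𝔻 : Comonad ℓ) →
    let D = Comonad.functor 𝔻 in
    {X Y : Set ℓ} (k : Algebra D Y) (k‡ : Comonad.F₀ 𝔻 X → Y) →
    IsCoKleisliInductiveSolution 𝔻 k k‡ →
    (f : Coalgebra D X) → IsComonadCoalgebra 𝔻 f →
    IsCAHomomorphism D f k (k‡ ∘ f)
theorem2p13 𝔻 k k‡ solution f isCoalgebra x = begin
  k‡ (f x)                  ≡⟨ solution (f x) ⟩
  -- The two sides of `comult x` are elements of `F₀ (F₀ X)`, not functions under `map`, so plain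
  -- `cong` transports the equation.
  k (map k‡ (ν (f x)))      ≡⟨ cong (k ∘ map k‡) (comult x) ⟩
  k (map k‡ (map f (f x)))  ≡⟨ cong k (map-∘ k‡ f (f x)) ⟨
  k (map (k‡ ∘ f) (f x))    ∎
  where
  open Comonad 𝔻
  open IsComonadCoalgebra isCoalgebra
  open ≡-Reasoning
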